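{- The category $\mathcal{LI}$ of intuitionistic abstract logics with strongly stable logic maps is equivalent to the category $\mathcal{Hey}$ of Heyting algebras with Heyting algebra morphisms.
   Context: An abstract logic is a triple $\mathcal{L}=(Expr_{\mathcal{L}},Th_{\mathcal{L}},\mathcal{C}_{\mathcal{L}})$ where $Expr_{\mathcal{L}}$ is a set (of expressions), $Th_{\mathcal{L}}$ is a non-empty set of subsets of $Expr_{\mathcal{L}}$ (the theories) such that $\bigcap\mathcal{T}\in Th_{\mathcal{L}}$ for every non-empty $\mathcal{T}\subseteq Th_{\mathcal{L}}$, and $\mathcal{C}_{\mathcal{L}}$ is a set of operations on $Expr_{\mathcal{L}}$ (connectives). $\mathcal{L}$ is closed under union of chains if the union of every non-empty chain of theories is a theory. A theory $T$ is prime if for every non-empty finite $\mathcal{T}\subseteq Th_{\mathcal{L}}$ with $T=\bigcap\mathcal{T}$ we have $T\in\mathcal{T}$; it is totally prime if this holds for every non-empty $\mathcal{T}\subseteq Th_{\mathcal{L}}$ of arbitrary cardinality. $PTh_{\mathcal{L}}$ and $TPTh_{\mathcal{L}}$ denote the sets of prime and totally prime theories. An intuitionistic abstract logic is an abstract logic closed under union of chains with binary connectives $\vee,\wedge,\to$ and constants $\top,\bot$ such that for all $a,b\in Expr_{\mathcal{L}}$ and all $T\in TPTh_{\mathcal{L}}$: $a\vee b\in T$ iff $a\in T$ or $b\in T$; $a\wedge b\in T$ iff $a\in T$ and $b\in T$; $a\to b\in T$ iff for every totally prime $T'\supseteq T$, $a\in T'$ implies $b\in T'$; $\top$ belongs to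 every theory and $\bot$ to no theory. A logic application $h:\mathcal{L}\to\mathcal{L}'$ is a function $h:Expr_{\mathcal{L}}\to Expr_{\mathcal{L}'}$ with $h^{ -1}(T')\in Th_{\mathcal{L}}$ for all $T'\in Th_{\mathcal{L}'}$; it is stable if moreover $h^{ -1}(P')\in PTh_{\mathcal{L}}$ for all $P'\in PTh_{\mathcal{L}'}$; it is strongly stable if it is stable and for all $P'\in PTh_{\mathcal{L}'}$ and $P\in PTh_{\mathcal{L}}$ with $h^{ -1}(P')\subseteq P$ there is $Q'\in PTh_{\mathcal{L}'}$ with $P'\subseteq Q'$ and $h^{ -1}(Q')=P$. $\mathcal{LI}$ has intuitionistic abstract logics as objects and strongly stable logic applications as morphisms.
   Formalization: Strongly stable logic maps are identified when their values are logically equivalent (with equality of functions LI has no initial object, but Hey has one), and Heyting algebras are nontrivial (no logic corresponds to the one-element algebra, since ⊤ is in every theory and ⊥ in none). -}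

module Defs where

open import Algebra.Core using (Op₂)
open import Algebra.Morphism.Definitions using (Homomorphic₀; Homomorphic₂)
open import Data.Fin.Base using (Fin)
open import Data.Nat.Base using (ℕ)
open import Data.Product.Base using (Σ; ∃; ∃-syntax; _×_; _,_; proj₁; proj₂)
open import Data.Sum.Base using (_⊎_)
open import Data.Vec.Base using (Vec; []; _∷_)
open import Function.Base using (id; _∘′_)
open import Function.Bundles using (_⇔_; Equivalence; mk⇔)
open import Level using (Level; _⊔_; suc)
open import Relation.Binary.Bundles using (Poset)
open import Relation.Binary.Core using (Rel)
open import Relation.Binary.Definitions using (_Respects_)
open import Relation.Binary.Lattice.Bundles using (HeytingAlgebra)
open import Relation.Binary.Structures using (IsEquivalence)
open import Relation.Nullary.Negation.Core using (¬_)
open import Relation.Unary using (Pred; _∈_; _⊆_; _≐_; ⋃; ⋂; Satisfiable)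

-- Hom-sets are setoids: all equations between morphisms are up to _≈_.
record Category (o m e : Level) : Set (suc (o ⊔ m ⊔ e)) where
  infix  4 _≈_
  infixr 9 _∘_
  field
    Obj       : Set o
    Hom       : Obj → Obj → Set m
    _≈_       : ∀ {A B} → Rel (Hom A B) e
    idm       : ∀ {A} → Hom A A
    _∘_       : ∀ {A B C} → Hom B C → Hom A B → Hom A C
    equiv     : ∀ {A B} → IsEquivalence (_≈_ {A} {B})
    assoc     : ∀ {A B C D} (f : Hom A B) (g : Hom B C) (h : Hom C D) →
                (h ∘ g) ∘ f ≈ h ∘ (g ∘ f)
    identityˡ : ∀ {A B} (f : Hom A B) → idm ∘ f ≈ f
    identityʳ : ∀ {A B} (f : Hom A B) → f ∘ idm ≈ f
    ∘-resp-≈  : ∀ {A B C} {g g′ : Hom B C} {f f′ : Hom A B} →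
                g ≈ g′ → f ≈ f′ → g ∘ f ≈ g′ ∘ f′

private
  variable
    o m e o′ m′ e′ o″ m″ e″ : Level

record Functor (C : Category o m e) (D : Category o′ m′ e′) :
               Set (o ⊔ m ⊔ e ⊔ o′ ⊔ m′ ⊔ e′) where
  private
    module C = Category C
    module D = Category D
  field
    F₀       : C.Obj → D.Obj
    F₁       : ∀ {A B} → C.Hom A B → D.Hom (F₀ A) (F₀ B)
    F-resp-≈ : ∀ {A B} {f g : C.Hom A B} → f C.≈ g → F₁ f D.≈ F₁ g
    F-id     : ∀ {A} → F₁ (C.idm {A}) D.≈ D.idm
    F-∘      : ∀ {A B E} (f : C.Hom A B) (g : C.Hom B E) →
               F₁ (g C.∘ f) D.≈ F₁ g D.∘ F₁ f

idF : (C : Category o m e) → Functor C C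
idF C = record
  { F₀ = id ; F₁ = id ; F-resp-≈ = id ; F-id = refl ; F-∘ = λ _ _ → refl }
  where
  open module E {A B} = IsEquivalence (Category.equiv C {A} {B}) using (refl)

_∘F_ : {C : Category o m e} {D : Category o′ m′ e′} {E : Category o″ m″ e″} →
       Functor D E → Functor C D → Functor C E
_∘F_ {E = E} G F = record
  { F₀       = G.F₀ ∘′ F.F₀
  ; F₁       = G.F₁ ∘′ F.F₁
  ; F-resp-≈ = G.F-resp-≈ ∘′ F.F-resp-≈
  ; F-id     = trans (G.F-resp-≈ F.F-id) G.F-id
  ; F-∘      = λ f g → trans (G.F-resp-≈ (F.F-∘ f g)) (G.F-∘ (F.F₁ f) (F.F₁ g))
  }
  where
  module F = Functor F
  module G = Functor G
  open module Eq {A B} = IsEquivalence (Category.equiv E {A} {B}) using (trans)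

record NaturalIsomorphism {C : Category o m e} {D : Category o′ m′ e′}
                          (F G : Functor C D) :
                          Set (o ⊔ m ⊔ e ⊔ o′ ⊔ m′ ⊔ e′) where
  private
    module C = Category C
    module F = Functor F
    module G = Functor G
  open Category D
  field
    to      : ∀ A → Hom (F.F₀ A) (G.F₀ A)
    from    : ∀ A → Hom (G.F₀ A) (F.F₀ A)
    natural : ∀ {A B} (f : C.Hom A B) → to B ∘ F.F₁ f ≈ G.F₁ f ∘ to A
    from∘to : ∀ A → from A ∘ to A ≈ idm
    to∘from : ∀ A → to A ∘ from A ≈ idm

record CategoricalEquivalence (C : Category o m e) (D : Category o′ m′ e′) :
                              Set (o ⊔ m ⊔ e ⊔ o′ ⊔ m′ ⊔ e′) where
  field
    F      : Functor C D
    G      : Functor D C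
    unit   : NaturalIsomorphism (idF C) (G ∘F F)
    counit : NaturalIsomorphism (F ∘F G) (idF D)

-- Zorn's lemma is not derivable here; it is only ever used as a hypothesis.
ZornsLemma : (c ℓ₁ ℓ₂ p : Level) → Set (suc (c ⊔ ℓ₁ ⊔ ℓ₂ ⊔ p))
ZornsLemma c ℓ₁ ℓ₂ p = (P : Poset c ℓ₁ ℓ₂) → let open Poset P in
  Carrier →
  ((C : Pred Carrier p) → Satisfiable C →
     (∀ {x y} → x ∈ C → y ∈ C → x ≤ y ⊎ y ≤ x) →
     ∃[ u ] (∀ {x} → x ∈ C → x ≤ u)) →
  ∃[ m ] (∀ {x} → m ≤ x → m ≈ x)

-- Subsets are identified when extensionally equal (_≐_), so membership
-- of a subset in a set of subsets is taken up to _≐_.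

module _ {ℓ} {A : Set ℓ} where

  Family : Set (suc ℓ)
  Family = Pred (Pred A ℓ) ℓ

  infix 4 _∈≐_
  _∈≐_ : Pred A ℓ → Family → Set (suc ℓ)
  T ∈≐ 𝒯 = ∃[ S ] S ∈ 𝒯 × S ≐ T

  -- These land in Pred A (suc ℓ), whence closure of a family under them
  -- is expressed below by the existence of an equal member.
  ⋂₀ ⋃₀ : Family → Pred A (suc ℓ)
  ⋂₀ 𝒯 = ⋂ (∃ 𝒯) proj₁
  ⋃₀ 𝒯 = ⋃ (∃ 𝒯) proj₁

  Chain : Family → Set (suc ℓ)
  Chain 𝒯 = ∀ {S T} → S ∈ 𝒯 → T ∈ 𝒯 → S ⊆ T ⊎ T ⊆ S

  Finite : Family → Set (suc ℓ)
  Finite 𝒯 = ∃[ n ] Σ (Fin n → Pred A ℓ) λ S →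
    (∀ i → S i ∈ 𝒯) × (∀ {T} → T ∈ 𝒯 → ∃[ i ] S i ≐ T)

record AbstractLogic ℓ : Set (suc ℓ) where
  field
    Expr        : Set ℓ
    Th          : Pred (Pred Expr ℓ) ℓ
    Th-resp-≐   : Th Respects _≐_
    Th-nonEmpty : Satisfiable Th
    Th-⋂        : ∀ 𝒯 → Satisfiable 𝒯 → 𝒯 ⊆ Th → ∃[ T ] T ∈ Th × T ≐ ⋂₀ 𝒯
    Con         : ∀ n → Pred (Vec Expr n → Expr) ℓ

  ClosedUnderUnionOfChains : Set (suc ℓ)
  ClosedUnderUnionOfChains =
    ∀ 𝒯 → Satisfiable 𝒯 → 𝒯 ⊆ Th → Chain 𝒯 → ∃[ T ] T ∈ Th × T ≐ ⋃₀ 𝒯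

  PTh TPTh : Pred (Pred Expr ℓ) (suc ℓ)
  PTh  T = T ∈ Th × (∀ 𝒯 → Satisfiable 𝒯 → Finite 𝒯 → 𝒯 ⊆ Th → T ≐ ⋂₀ 𝒯 → T ∈≐ 𝒯)
  TPTh T = T ∈ Th × (∀ 𝒯 → Satisfiable 𝒯 → 𝒯 ⊆ Th → T ≐ ⋂₀ 𝒯 → T ∈≐ 𝒯)

nullary : ∀ {a} {A : Set a} → A → Vec A 0 → A
nullary c [] = c

binary : ∀ {a} {A : Set a} → Op₂ A → Vec A 2 → A
binary _∙_ (x ∷ y ∷ []) = x ∙ y

record IntuitionisticLogic ℓ : Set (suc ℓ) where
  field
    abstractLogic : AbstractLogic ℓ
  open AbstractLogic abstractLogic public
  infixr 5 _⇒_
  infixr 6 _∨_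
  infixr 7 _∧_
  field
    chainClosed : ClosedUnderUnionOfChains
    _∨_ _∧_ _⇒_ : Op₂ Expr
    ⊤ ⊥         : Expr
    ∨-Con       : binary _∨_ ∈ Con 2
    ∧-Con       : binary _∧_ ∈ Con 2
    ⇒-Con       : binary _⇒_ ∈ Con 2
    ⊤-Con       : nullary ⊤ ∈ Con 0
    ⊥-Con       : nullary ⊥ ∈ Con 0
    ∨-true      : ∀ a b {T} → T ∈ TPTh → (a ∨ b) ∈ T ⇔ (a ∈ T ⊎ b ∈ T)
    ∧-true      : ∀ a b {T} → T ∈ TPTh → (a ∧ b) ∈ T ⇔ (a ∈ T × b ∈ T)
    ⇒-true      : ∀ a b {T} → T ∈ TPTh →
                  (a ⇒ b) ∈ T ⇔ (∀ {T′} → T′ ∈ TPTh → T ⊆ T′ → a ∈ T′ → b ∈ T′)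
    ⊤-true      : ∀ {T} → T ∈ Th → ⊤ ∈ T
    ⊥-false     : ∀ {T} → T ∈ Th → ¬ (⊥ ∈ T)

-- The inverse image of T under h is T ∘′ h.
module _ {ℓ} (L L′ : AbstractLogic ℓ) where
  private
    module L  = AbstractLogic L
    module L′ = AbstractLogic L′

  IsLogicApplication : Pred (L.Expr → L′.Expr) (suc ℓ)
  IsLogicApplication h = ∀ {T′} → T′ ∈ L′.Th → T′ ∘′ h ∈ L.Th

  record IsStable (h : L.Expr → L′.Expr) : Set (suc ℓ) where
    field
      isLogicApplication : IsLogicApplication h
      stable             : ∀ {P′} → P′ ∈ L′.PTh → P′ ∘′ h ∈ L.PTh

  record IsStronglyStable (h : L.Expr → L′.Expr) : Set (suc ℓ) where
    field
      isStable       : IsStable h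
      stronglyStable : ∀ {P′ P} → P′ ∈ L′.PTh → P ∈ L.PTh → P′ ∘′ h ⊆ P →
                       ∃[ Q′ ] Q′ ∈ L′.PTh × P′ ⊆ Q′ × Q′ ∘′ h ≐ P
    open IsStable isStable public

module _ {ℓ} (L : AbstractLogic ℓ) where
  open AbstractLogic L

  LogicallyEquivalent : Rel Expr (suc ℓ)
  LogicallyEquivalent a b = ∀ {T} → T ∈ Th → a ∈ T ⇔ b ∈ T

-- Two strongly stable applications represent the same logic map when their
-- values are logically equivalent, i.e. when they have the same inverse
-- images of theories.  With equality of functions on the nose the category
-- would distinguish logics that differ only in how many logically equivalent
-- copies of each expression they contain.
LI : ∀ ℓ → Category (suc ℓ) (suc ℓ) (suc ℓ)
LI ℓ = record
  { Obj       = IntuitionisticLogic ℓ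
  ; Hom       = λ L L′ → ∃ (IsStronglyStable (logic L) (logic L′))
  ; _≈_       = λ {L} {L′} (h , _) (k , _) → ∀ a → LogicallyEquivalent (logic L′) (h a) (k a)
  ; idm       = id , record
    { isStable       = record { isLogicApplication = id ; stable = id }
    ; stronglyStable = λ {_} {P} _ p P′⊆P → P , p , P′⊆P , id , id
    }
  ; _∘_       = λ {L} {L′} {L″} (k , ks) (h , hs) → k ∘′ h , ∘-strong {L} {L′} {L″} ks hs
  ; equiv     = record
    { refl  = λ _ _ → mk⇔ id id
    ; sym   = λ h≈k a t → mk⇔ (from (h≈k a t)) (to (h≈k a t))
    ; trans = λ h≈k k≈l a t → mk⇔ (to (k≈l a t) ∘′ to (h≈k a t)) (from (h≈k a t) ∘′ from (k≈l a t))
    }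
  ; assoc     = λ _ _ _ _ _ → mk⇔ id id
  ; identityˡ = λ _ _ _ → mk⇔ id id
  ; identityʳ = λ _ _ _ → mk⇔ id id
  ; ∘-resp-≈  = λ {_} {_} {_} {(_ , ks)} {_} {(h , _)} {(h′ , _)} k≈k′ h≈h′ a t →
      let t′ = IsStronglyStable.isLogicApplication ks t in
      mk⇔ (to (k≈k′ (h′ a) t) ∘′ to (h≈h′ a t′)) (from (h≈h′ a t′) ∘′ from (k≈k′ (h′ a) t))
  }
  where
  open Equivalence using (to; from)
  logic = IntuitionisticLogic.abstractLogic

  ∘-strong : ∀ {L L′ L″ : IntuitionisticLogic ℓ} {k h} →
             IsStronglyStable (logic L′) (logic L″) k →
             IsStronglyStable (logic L) (logic L′) h →
             IsStronglyStable (logic L) (logic L″) (k ∘′ h)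
  ∘-strong {k = k} {h} ks hs = record
    { isStable       = record
      { isLogicApplication = λ t → H.isLogicApplication (K.isLogicApplication t)
      ; stable             = λ p → H.stable (K.stable p)
      }
    ; stronglyStable = λ p″ p P″⊆P →
        let Q′ , q′ , P″⊆Q′ , Q′⊆P , P⊆Q′    = H.stronglyStable (K.stable p″) p P″⊆P
            Q″ , q″ , P″⊆Q″ , Q″⊆Q′ , Q′⊆Q″ = K.stronglyStable p″ q′ P″⊆Q′
        in  Q″ , q″ , P″⊆Q″ , (λ x → Q′⊆P (Q″⊆Q′ x)) , (λ x → Q′⊆Q″ (P⊆Q′ x))
    }
    where
    module K = IsStronglyStable ks
    module H = IsStronglyStable hs

-- The degenerate algebra is excluded: an intuitionistic logic has a theory,
-- which contains ⊤ and not ⊥.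
record NontrivialHeytingAlgebra ℓ : Set (suc ℓ) where
  field
    heytingAlgebra : HeytingAlgebra ℓ ℓ ℓ
  open HeytingAlgebra heytingAlgebra public
  field
    nontrivial : ¬ (⊤ ≈ ⊥)

record IsHeytingHomomorphism {ℓ} (H K : HeytingAlgebra ℓ ℓ ℓ)
         (f : HeytingAlgebra.Carrier H → HeytingAlgebra.Carrier K) : Set ℓ where
  private
    module H = HeytingAlgebra H
    module K = HeytingAlgebra K
  field
    cong   : ∀ {x y} → x H.≈ y → f x K.≈ f y
    ∨-homo : Homomorphic₂ H.Carrier K.Carrier K._≈_ f H._∨_ K._∨_
    ∧-homo : Homomorphic₂ H.Carrier K.Carrier K._≈_ f H._∧_ K._∧_
    ⇨-homo : Homomorphic₂ H.Carrier K.Carrier K._≈_ f H._⇨_ K._⇨_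
    ⊤-homo : Homomorphic₀ H.Carrier K.Carrier K._≈_ f H.⊤ K.⊤
    ⊥-homo : Homomorphic₀ H.Carrier K.Carrier K._≈_ f H.⊥ K.⊥

Hey : ∀ ℓ → Category (suc ℓ) ℓ ℓ
Hey ℓ = record
  { Obj       = NontrivialHeytingAlgebra ℓ
  ; Hom       = λ H K → ∃ (IsHeytingHomomorphism (heytingAlgebra H) (heytingAlgebra K))
  ; _≈_       = λ {_} {K} (f , _) (g , _) → ∀ x → _≈_ K (f x) (g x)
  ; idm       = λ {H} → id , record
    { cong   = id
    ; ∨-homo = λ _ _ → Eq.refl H
    ; ∧-homo = λ _ _ → Eq.refl H
    ; ⇨-homo = λ _ _ → Eq.refl H
    ; ⊤-homo = Eq.refl H
    ; ⊥-homo = Eq.refl H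
    }
  ; _∘_       = λ {_} {_} {M} (g , gh) (f , fh) →
      let module g = IsHeytingHomomorphism gh
          module f = IsHeytingHomomorphism fh
          infixr 5 _⨾_
          _⨾_ = Eq.trans M
      in g ∘′ f , record
    { cong   = λ p → g.cong (f.cong p)
    ; ∨-homo = λ x y → g.cong (f.∨-homo x y) ⨾ g.∨-homo (f x) (f y)
    ; ∧-homo = λ x y → g.cong (f.∧-homo x y) ⨾ g.∧-homo (f x) (f y)
    ; ⇨-homo = λ x y → g.cong (f.⇨-homo x y) ⨾ g.⇨-homo (f x) (f y)
    ; ⊤-homo = g.cong f.⊤-homo ⨾ g.⊤-homo
    ; ⊥-homo = g.cong f.⊥-homo ⨾ g.⊥-homo
    }
  ; equiv     = λ {_} {K} → record
    { refl  = λ _ → Eq.refl K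
    ; sym   = λ p x → Eq.sym K (p x)
    ; trans = λ p q x → Eq.trans K (p x) (q x)
    }
  ; assoc     = λ {_} {_} {_} {K} _ _ _ _ → Eq.refl K
  ; identityˡ = λ {_} {K} _ _ → Eq.refl K
  ; identityʳ = λ {_} {K} _ _ → Eq.refl K
  ; ∘-resp-≈  = λ {_} {_} {M} {(_ , gh)} {_} {_} {(f′ , _)} p q x →
      Eq.trans M (IsHeytingHomomorphism.cong gh (q x)) (p (f′ x))
  }
  where
  open NontrivialHeytingAlgebra

{-# OPTIONS --safe #-}

-- A logic L is sent to its Lindenbaum algebra, ordered by a ≤ b iff every
-- theory containing a contains b, and a Heyting algebra to the logic on its
-- carrier whose theories are the proper filters.  By Zorn's lemma every
-- theory is the intersection of totally prime ones, so the semantic clauses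
-- make the Lindenbaum algebra a Heyting algebra whose proper filters include
-- the theories.  Conversely, given a proper filter F, a maximal theory M
-- inside F equals F: for a ∈ F ∖ M the theory generated by M and a consists
-- of the b with a ⇒ b ∈ M ⊆ F, so by modus ponens it still lies inside F.
-- Hence the unit and the counit are the identity on carriers.
--
-- On morphisms: the prime theories are the prime filters, these separate
-- points, and strong stability is exactly Esakia's condition that the inverse
-- image map on prime filters is a p-morphism, so that the strongly stable maps
-- of filter logics are the Heyting homomorphisms.

module Submission where

open import Defs
open import Axiom.DoubleNegationElimination using (em⇒dne)
open import Axiom.ExcludedMiddle using (ExcludedMiddle)
open import Data.Empty using (⊥-elim)
open import Data.Fin.Base using (Fin; zero; suc)
open import Data.Nat.Base using (zero; suc)
open import Data.Product.Base using (∃-syntax; _×_; _,_; proj₁; proj₂; swap)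
open import Data.Sum.Base as Sum using (_⊎_; inj₁; inj₂; [_,_]′)
open import Data.Unit.Polymorphic.Base using (tt) renaming (⊤ to Unit)
open import Function.Base using (id; _∘′_)
open import Function.Bundles using (Equivalence; mk⇔)
open import Level using (Level) renaming (suc to lsuc)
open import Relation.Binary.Bundles using (Poset)
import Relation.Binary.Lattice.Properties.HeytingAlgebra as HeytingProperties
import Relation.Binary.Lattice.Properties.JoinSemilattice as JoinProperties
open import Relation.Binary.PropositionalEquality.Core using (_≢_; refl)
open import Relation.Nullary.Decidable.Core using (True; toWitness; fromWitness)
open import Relation.Nullary.Negation.Core using (¬_; contradiction)
open import Relation.Unary using (Pred; _∈_; _∉_; _⊆_; _≐_; Satisfiable)
open import Relation.Unary.Properties using (≐-refl; ≐-sym; ≐-trans)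

-- `PTh` with the set of theories as a parameter, so that primality can be carried between two
-- logics on the same expressions.
IsPrime : ∀ {ℓ} {A : Set ℓ} → Family {A = A} → Pred (Pred A ℓ) (lsuc ℓ)
IsPrime Th T =
  T ∈ Th × (∀ 𝒯 → Satisfiable 𝒯 → Finite 𝒯 → 𝒯 ⊆ Th → T ≐ ⋂₀ 𝒯 → T ∈≐ 𝒯)

IsPrime-resp : ∀ {ℓ} {A : Set ℓ} {Th Th′ : Family {A = A}} →
               Th ⊆ Th′ → Th′ ⊆ Th → IsPrime Th ⊆ IsPrime Th′
IsPrime-resp Th⊆Th′ Th′⊆Th (t , prime) =
  Th⊆Th′ t , λ 𝒯 sat fin 𝒯⊆Th′ → prime 𝒯 sat fin (Th′⊆Th ∘′ 𝒯⊆Th′)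

module _ {ℓ : Level} (L : AbstractLogic ℓ) where
  open AbstractLogic L

  TPTh⊆PTh : TPTh ⊆ PTh
  TPTh⊆PTh (t , tp) = t , λ 𝒯 sat _ → tp 𝒯 sat

-- Proper and prime filters.

module _ {ℓ : Level} (H : NontrivialHeytingAlgebra ℓ) where
  open NontrivialHeytingAlgebra H
  open HeytingProperties heytingAlgebra using (⇨-eval)

  record IsProperFilter (F : Pred Carrier ℓ) : Set ℓ where
    field
      upward   : ∀ {x y} → x ≤ y → x ∈ F → y ∈ F
      ∧-closed : ∀ {x y} → x ∈ F → y ∈ F → (x ∧ y) ∈ F
      ⊤∈       : ⊤ ∈ F
      ⊥∉       : ⊥ ∉ F

    modusPonens : ∀ {x y} → (x ⇨ y) ∈ F → x ∈ F → y ∈ F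
    modusPonens x⇨y∈F x∈F = upward ⇨-eval (∧-closed x⇨y∈F x∈F)

  record IsPrimeFilter (F : Pred Carrier ℓ) : Set ℓ where
    field
      isProperFilter : IsProperFilter F
      prime          : ∀ {x y} → (x ∨ y) ∈ F → x ∈ F ⊎ y ∈ F
    open IsProperFilter isProperFilter public

module _ (em : ∀ {a} → ExcludedMiddle a)
         (zorn : ∀ {c ℓ₁ ℓ₂ p} → ZornsLemma c ℓ₁ ℓ₂ p) where

  byContradiction : ∀ {a} {P : Set a} → ¬ ¬ P → P
  byContradiction = em⇒dne em

  ⊈⇒∃∉ : ∀ {a p q} {A : Set a} {P : Pred A p} {Q : Pred A q} →
         ¬ (P ⊆ Q) → ∃[ x ] x ∈ P × x ∉ Q
  ⊈⇒∃∉ P⊈Q = byContradiction λ none →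
    P⊈Q λ {x} x∈P → byContradiction λ x∉Q → none (x , x∈P , x∉Q)

  -- Excluded middle makes the universe of propositions impredicative.
  record Resize {a} b (P : Set a) : Set b where
    constructor resized
    field holds : True (em {P = P})

  resize : ∀ {a b} {P : Set a} → P → Resize b P
  resize p = resized (fromWitness p)

  unresize : ∀ {a b} {P : Set a} → Resize b P → P
  unresize r = toWitness (Resize.holds r)

  -- Maximal and totally prime theories.

  module _ {ℓ : Level} (L : AbstractLogic ℓ)
           (chainClosed : AbstractLogic.ClosedUnderUnionOfChains L) where
    open AbstractLogic L

    -- Zorn's lemma for the theories between `T` and `U`: the union of a chain stays inside `U`
    -- because each member does. The bound `U` will be the complement of a point, the complement of
    -- an ideal, or a filter.
    maximalTheoryWithin : ∀ (U : Pred Expr ℓ) {T} → T ∈ Th → T ⊆ U →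
      ∃[ M ] M ∈ Th × T ⊆ M × M ⊆ U × (∀ {S} → S ∈ Th → M ⊆ S → S ⊆ U → S ⊆ M)
    maximalTheoryWithin U {T} t T⊆U =
      let (M , m , T⊆M , M⊆U) , maximal = zorn poset (T , t , id , T⊆U) bounded
      in  M , m , T⊆M , M⊆U ,
          λ {S} s M⊆S S⊆U → proj₂ (maximal {S , s , M⊆S ∘′ T⊆M , S⊆U} M⊆S)
      where
      poset : Poset (lsuc ℓ) ℓ ℓ
      poset = record
        { Carrier = ∃[ S ] S ∈ Th × T ⊆ S × S ⊆ U
        ; _≈_     = λ (S , _) (S′ , _) → S ≐ S′
        ; _≤_     = λ (S , _) (S′ , _) → S ⊆ S′
        ; isPartialOrder = record
          { isPreorder = record
            { isEquivalence = record { refl = ≐-refl ; sym = ≐-sym ; trans = ≐-trans }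
            ; reflexive     = proj₁
            ; trans         = λ S⊆S′ S′⊆S″ x → S′⊆S″ (S⊆S′ x)
            }
          ; antisym = _,_
          }
        }
      open Poset poset using (Carrier; _≤_)

      bounded : (C : Pred Carrier ℓ) → Satisfiable C →
                (∀ {x y} → x ∈ C → y ∈ C → x ≤ y ⊎ y ≤ x) →
                ∃[ u ] (∀ {x} → x ∈ C → x ≤ u)
      bounded C (c@(S₀ , _ , T⊆S₀ , _) , c∈C) total =
        (V , v , (λ x → ⋃⊆V ((S₀ , resize (c , c∈C , ≐-refl)) , T⊆S₀ x)) , V⊆U) ,
        λ {d} d∈C x → ⋃⊆V ((proj₁ d , resize (d , d∈C , ≐-refl)) , x)
        where
        -- The existential over `Carrier` lives one level too high for a `Family`, hence the
        -- resizing.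
        𝒯 : Family
        𝒯 S = Resize ℓ (∃[ d ] d ∈ C × proj₁ d ≐ S)

        𝒯⊆Th : 𝒯 ⊆ Th
        𝒯⊆Th r = let (_ , s , _) , _ , S≐ = unresize r in Th-resp-≐ S≐ s

        chain : Chain 𝒯
        chain r r′ =
          let _ , d∈C  , S⊆ , ⊆S   = unresize r
              _ , d′∈C , S′⊆ , ⊆S′ = unresize r′
          in  Sum.map (λ le {_} x → S′⊆ (le (⊆S x))) (λ le {_} x → S⊆ (le (⊆S′ x)))
                (total d∈C d′∈C)

        union = chainClosed 𝒯 (S₀ , resize (c , c∈C , ≐-refl)) 𝒯⊆Th chain
        V     = proj₁ union
        v     = proj₁ (proj₂ union)
        V⊆⋃   = proj₁ (proj₂ (proj₂ union))
        ⋃⊆V   = proj₂ (proj₂ (proj₂ union))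

        V⊆U : V ⊆ U
        V⊆U x =
          let (_ , r) , x∈S = V⊆⋃ x
              (_ , _ , _ , S⊆U) , _ , _ , S⊆ = unresize r
          in  S⊆U (S⊆ x∈S)

    -- A theory maximal among those omitting a is totally prime: if it is an
    -- intersection, one of the intersected theories already omits a.
    totallyPrimeSeparation : ∀ {T a} → T ∈ Th → a ∉ T →
                             ∃[ M ] M ∈ TPTh × T ⊆ M × a ∉ M
    totallyPrimeSeparation {T} {a} t a∉T =
      let M , m , T⊆M , M⊆U , maximal = maximalTheoryWithin (a ≢_) t λ { x∈T refl → a∉T x∈T }
          tp : ∀ 𝒯 → Satisfiable 𝒯 → 𝒯 ⊆ Th → M ≐ ⋂₀ 𝒯 → M ∈≐ 𝒯
          tp 𝒯 _ 𝒯⊆Th (M⊆⋂ , ⋂⊆M) = byContradiction λ M∉𝒯 →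
            M⊆U (⋂⊆M λ (S , S∈𝒯) → byContradiction λ a∉S →
              let M⊆S : M ⊆ S
                  M⊆S x = M⊆⋂ x (S , S∈𝒯)
                  S≐M : S ≐ M
                  S≐M = maximal (𝒯⊆Th S∈𝒯) M⊆S (λ { x∈S refl → a∉S x∈S }) , M⊆S
              in  M∉𝒯 (S , S∈𝒯 , S≐M))
              refl
      in  M , (m , tp) , T⊆M , λ a∈M → M⊆U a∈M refl

    -- Contrapositive of `totallyPrimeSeparation`. The truth conditions speak of totally prime
    -- theories; this carries their consequences to all theories.
    ∈-fromTotallyPrime : ∀ {T a} → T ∈ Th →
                         (∀ {M} → M ∈ TPTh → T ⊆ M → a ∈ M) → a ∈ T
    ∈-fromTotallyPrime t a∈ = byContradiction λ a∉T →
      let _ , m , T⊆M , a∉M = totallyPrimeSeparation t a∉T in a∉M (a∈ m T⊆M)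

  -- The logic of proper filters.

  module FilterLogic {ℓ : Level} (H : NontrivialHeytingAlgebra ℓ) where
    open NontrivialHeytingAlgebra H
    open HeytingProperties heytingAlgebra
      using (⇨-unit; y≤x⇨y; ⇨ʳ-covariant; ⇨-distribˡ-∧-≥; ⇨-distribˡ-∨-∧-≥)
    open IsProperFilter

    principalFilter : ∀ {a} → ¬ (a ≤ ⊥) → IsProperFilter H (a ≤_)
    principalFilter a≰⊥ = record
      { upward   = λ x≤y a≤x → trans a≤x x≤y
      ; ∧-closed = ∧-greatest
      ; ⊤∈       = maximum _
      ; ⊥∉       = a≰⊥
      }

    filterLogic : AbstractLogic ℓ
    filterLogic = record
      { Expr        = Carrier
      ; Th          = IsProperFilter H
      ; Th-resp-≐   = λ (F⊆G , G⊆F) f → record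
        { upward   = λ x≤y x → F⊆G (upward f x≤y (G⊆F x))
        ; ∧-closed = λ x y → F⊆G (∧-closed f (G⊆F x) (G⊆F y))
        ; ⊤∈       = F⊆G (⊤∈ f)
        ; ⊥∉       = λ b → ⊥∉ f (G⊆F b)
        }
      ; Th-nonEmpty = (⊤ ≤_) , principalFilter λ ⊤≤⊥ → nontrivial (antisym ⊤≤⊥ (minimum ⊤))
      ; Th-⋂        = λ 𝒯 (S , S∈𝒯) 𝒯⊆ → (λ x → Resize ℓ (x ∈ ⋂₀ 𝒯)) , record
        { upward   = λ x≤y x → resize λ (G , g) → upward (𝒯⊆ g) x≤y (unresize x (G , g))
        ; ∧-closed = λ x y → resize λ (G , g) →
                     ∧-closed (𝒯⊆ g) (unresize x (G , g)) (unresize y (G , g))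
        ; ⊤∈       = resize λ (_ , g) → ⊤∈ (𝒯⊆ g)
        -- Non-emptiness of `𝒯` matters here: the empty intersection would contain `⊥`.
        ; ⊥∉       = λ b → ⊥∉ (𝒯⊆ S∈𝒯) (unresize b (S , S∈𝒯))
        } , unresize , resize
      ; Con         = λ _ _ → Unit
      }
    open AbstractLogic filterLogic using (Th; Th-resp-≐; PTh; TPTh; ClosedUnderUnionOfChains)

    filters-chainClosed : ClosedUnderUnionOfChains
    filters-chainClosed 𝒯 (S , S∈𝒯) 𝒯⊆ chain = (λ x → Resize ℓ (x ∈ ⋃₀ 𝒯)) , record
      { upward   = λ x≤y x → let (G , g) , x∈G = unresize x in
                   resize ((G , g) , upward (𝒯⊆ g) x≤y x∈G)
      ; ∧-closed = λ x y →
          let (F , f) , x∈F = unresize x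
              (G , g) , y∈G = unresize y
          in [ (λ F⊆G → resize ((G , g) , ∧-closed (𝒯⊆ g) (F⊆G x∈F) y∈G))
             , (λ G⊆F → resize ((F , f) , ∧-closed (𝒯⊆ f) x∈F (G⊆F y∈G)))
             ]′ (chain f g)
      ; ⊤∈       = resize ((S , S∈𝒯) , ⊤∈ (𝒯⊆ S∈𝒯))
      ; ⊥∉       = λ b → let (_ , g) , ⊥∈G = unresize b in ⊥∉ (𝒯⊆ g) ⊥∈G
      } , unresize , resize

    -- The filter generated by F and a.
    _[_] : Pred Carrier ℓ → Carrier → Pred Carrier ℓ
    (F [ a ]) x = (a ⇨ x) ∈ F

    module _ {F : Pred Carrier ℓ} (f : IsProperFilter H F) where

      ⊆-[] : ∀ {a} → F ⊆ F [ a ]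
      ⊆-[] = upward f y≤x⇨y

      ∈-[] : ∀ {a} → a ∈ F [ a ]
      ∈-[] = upward f (reflexive (Eq.sym ⇨-unit)) (⊤∈ f)

      []-isProperFilter : ∀ {a} → (a ⇨ ⊥) ∉ F → IsProperFilter H (F [ a ])
      []-isProperFilter ¬a∉F = record
        { upward   = λ x≤y → upward f (⇨ʳ-covariant x≤y)
        ; ∧-closed = λ x y → upward f (⇨-distribˡ-∧-≥ _ _ _) (∧-closed f x y)
        ; ⊤∈       = ⊆-[] (⊤∈ f)
        ; ⊥∉       = ¬a∉F
        }

      -- Disjunction elimination inside a filter; equivalently, `F [ a ]` and `F [ b ]` meet inside
      -- `F` once `a ∨ b` is in `F`.
      byCases : ∀ {a b c} → (a ∨ b) ∈ F → (a ⇨ c) ∈ F → (b ⇨ c) ∈ F → c ∈ F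
      byCases a∨b a⇨c b⇨c =
        modusPonens f (upward f (⇨-distribˡ-∨-∧-≥ _ _ _) (∧-closed f a⇨c b⇨c)) a∨b

    -- If a ∨ b ∈ P then P = P [ a ] ∩ P [ b ].
    PTh⇒prime : ∀ {P} → P ∈ PTh → IsPrimeFilter H P
    PTh⇒prime {P} (f , pr) = record
      { isProperFilter = f
      ; prime          = λ a∨b → byContradiction λ neither → neither (oneOf a∨b neither)
      }
      where
      module _ {a b : Carrier} (a∨b : (a ∨ b) ∈ P) (neither : ¬ (a ∈ P ⊎ b ∈ P)) where
        -- This makes `P [ a ]` proper: with `a ⇨ ⊥` also `a ⇨ b` would be in `P`, and cases on
        -- `a ∨ b` would yield `b`.
        ¬a∉P : (a ⇨ ⊥) ∉ P
        ¬a∉P ¬a = neither (inj₂ (byCases f a∨b (upward f (⇨ʳ-covariant (minimum b)) ¬a) (∈-[] f)))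

        ¬b∉P : (b ⇨ ⊥) ∉ P
        ¬b∉P ¬b = neither (inj₁ (byCases f a∨b (∈-[] f) (upward f (⇨ʳ-covariant (minimum a)) ¬b)))

        𝒯 : Family
        𝒯 S = S ≐ P [ a ] ⊎ S ≐ P [ b ]

        𝒯⊆Th : 𝒯 ⊆ Th
        𝒯⊆Th (inj₁ S≐) = Th-resp-≐ (swap S≐) ([]-isProperFilter f ¬a∉P)
        𝒯⊆Th (inj₂ S≐) = Th-resp-≐ (swap S≐) ([]-isProperFilter f ¬b∉P)

        finite : Finite 𝒯
        finite = 2 , (λ { zero → P [ a ] ; (suc _) → P [ b ] })
               , (λ { zero → inj₁ ≐-refl ; (suc _) → inj₂ ≐-refl })
               , [ (λ S≐ → zero , swap S≐) , (λ S≐ → suc zero , swap S≐) ]′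

        P⊆⋂ : P ⊆ ⋂₀ 𝒯
        P⊆⋂ x (_ , inj₁ (_ , ⊆S)) = ⊆S (⊆-[] f x)
        P⊆⋂ x (_ , inj₂ (_ , ⊆S)) = ⊆S (⊆-[] f x)

        ⋂⊆P : ⋂₀ 𝒯 ⊆ P
        ⋂⊆P x = byCases f a∨b (x (P [ a ] , inj₁ ≐-refl)) (x (P [ b ] , inj₂ ≐-refl))

        oneOf : a ∈ P ⊎ b ∈ P
        oneOf with pr 𝒯 (P [ a ] , inj₁ ≐-refl) finite 𝒯⊆Th (P⊆⋂ , ⋂⊆P)
        ... | _ , inj₁ (_ , ⊆S) , S⊆P , _ = inj₁ (S⊆P (⊆S (∈-[] f)))
        ... | _ , inj₂ (_ , ⊆S) , S⊆P , _ = inj₂ (S⊆P (⊆S (∈-[] f)))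

    module _ {P : Pred Carrier ℓ} (p : IsPrimeFilter H P) where
      private module P = IsPrimeFilter p

      -- Pick a point of each `S i` outside `P`. Their join lies in every `S i`, and primality keeps
      -- it outside `P`; for no filters at all it is `⊥`.
      finiteIntersection⊈prime : ∀ n (S : Fin n → Pred Carrier ℓ) →
        (∀ i → IsProperFilter H (S i)) → (∀ i → ¬ (S i ⊆ P)) →
        ∃[ x ] (∀ i → x ∈ S i) × x ∉ P
      finiteIntersection⊈prime zero    S s S⊈P = ⊥ , (λ ()) , P.⊥∉
      finiteIntersection⊈prime (suc n) S s S⊈P =
        let x , x∈S₀ , x∉P = ⊈⇒∃∉ (S⊈P zero)
            y , y∈S  , y∉P = finiteIntersection⊈prime n (S ∘′ suc)
                               (λ i → s (suc i)) (λ i → S⊈P (suc i))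
        in  x ∨ y
          , (λ { zero    → upward (s zero) (x≤x∨y x y) x∈S₀
               ; (suc i) → upward (s (suc i)) (y≤x∨y x y) (y∈S i) })
          , λ x∨y∈P → [ x∉P , y∉P ]′ (P.prime x∨y∈P)

      -- Every member contains `P`, so a member inside `P` would equal it. If there is none, the
      -- join just built lies in the intersection but not in `P`.
      prime⇒PTh : P ∈ PTh
      prime⇒PTh = P.isProperFilter , λ 𝒯 _ (n , S , S∈𝒯 , cover) 𝒯⊆ (P⊆⋂ , ⋂⊆P) →
        byContradiction λ P∉𝒯 →
          let x , x∈S , x∉P = finiteIntersection⊈prime n S (λ i → 𝒯⊆ (S∈𝒯 i))
                λ i Si⊆P → P∉𝒯 (S i , S∈𝒯 i , (λ {_} → Si⊆P) , λ {_} y → P⊆⋂ y (S i , S∈𝒯 i))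
          in  x∉P (⋂⊆P λ (T , T∈𝒯) → let i , Si⊆T , _ = cover T∈𝒯 in Si⊆T (x∈S i))

    TPTh⇒prime : ∀ {P} → P ∈ TPTh → IsPrimeFilter H P
    TPTh⇒prime p = PTh⇒prime (TPTh⊆PTh filterLogic p)

    -- If `a ⇨ b` is not in `T`, then `T [ a ]` omits `b` and is therefore proper, and a totally
    -- prime filter above it still omits `b`.
    ⇨-true : ∀ {a b T} → T ∈ Th →
             (∀ {P} → P ∈ TPTh → T ⊆ P → a ∈ P → b ∈ P) → (a ⇨ b) ∈ T
    ⇨-true {a} {b} {T} t a→b = byContradiction λ a⇨b∉T →
      let g : IsProperFilter H (T [ a ])
          g = []-isProperFilter t λ ¬a → a⇨b∉T (upward t (⇨ʳ-covariant (minimum b)) ¬a)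
          _ , p , T[a]⊆P , b∉P = totallyPrimeSeparation filterLogic filters-chainClosed g a⇨b∉T
      in  b∉P (a→b p (λ x → T[a]⊆P (⊆-[] t x)) (T[a]⊆P (∈-[] t)))

    -- Prime filters separate points: if `a ≤ b` fails, the principal filter of `a` is proper and
    -- omits `b`.
    ≤-fromPrime : ∀ {a b} → (∀ {P} → IsPrimeFilter H P → a ∈ P → b ∈ P) → a ≤ b
    ≤-fromPrime {a} {b} a→b = byContradiction λ a≰b →
      let f = principalFilter λ a≤⊥ → a≰b (trans a≤⊥ (minimum b))
          _ , p , ↑a⊆P , b∉P = totallyPrimeSeparation filterLogic filters-chainClosed f a≰b
      in  b∉P (a→b (TPTh⇒prime p) (↑a⊆P (reflexive Eq.refl)))

    -- Take `M` maximal inside `U`. For `x` outside `M`, the filter `M [ x ]` must leave `U` at some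
    -- `i`, and likewise `y` gives `j`. With `x ∨ y` in `M` this puts `i ∨ j` in `M`, hence in `U`,
    -- although neither `i` nor `j` is.
    primeFilterTheorem : ∀ (U : Pred Carrier ℓ) → ⊥ ∉ U →
      (∀ {x y} → (x ∨ y) ∈ U → x ∈ U ⊎ y ∈ U) →
      ∀ {F} → IsProperFilter H F → F ⊆ U →
      ∃[ M ] IsPrimeFilter H M × F ⊆ M × M ⊆ U
    primeFilterTheorem U ⊥∉U U-prime f F⊆U =
      let M , m , F⊆M , M⊆U , maximal = maximalTheoryWithin filterLogic filters-chainClosed U f F⊆U
          escape : ∀ {x} → x ∉ M → ∃[ i ] (x ⇨ i) ∈ M × i ∉ U
          escape {x} x∉M = ⊈⇒∃∉ λ M[x]⊆U →
            x∉M (maximal ([]-isProperFilter m λ ¬x → ⊥∉U (M[x]⊆U ¬x)) (⊆-[] m) M[x]⊆U (∈-[] m))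
      in  M
        , record
          { isProperFilter = m
          ; prime = λ {x} {y} x∨y → byContradiction λ neither →
              let i , x⇨i , i∉U = escape λ x∈M → neither (inj₁ x∈M)
                  j , y⇨j , j∉U = escape λ y∈M → neither (inj₂ y∈M)
                  i∨j∈M = byCases m x∨y (upward m (⇨ʳ-covariant (x≤x∨y i j)) x⇨i)
                                        (upward m (⇨ʳ-covariant (y≤x∨y i j)) y⇨j)
              in  [ i∉U , j∉U ]′ (U-prime (M⊆U i∨j∈M))
          }
        , F⊆M , M⊆U

    intuitionisticLogic : IntuitionisticLogic ℓ
    intuitionisticLogic = record
      { abstractLogic = filterLogic
      ; chainClosed   = filters-chainClosed
      ; _∨_ = _∨_ ; _∧_ = _∧_ ; _⇒_ = _⇨_ ; ⊤ = ⊤ ; ⊥ = ⊥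
      ; ∨-Con = tt ; ∧-Con = tt ; ⇒-Con = tt ; ⊤-Con = tt ; ⊥-Con = tt
      ; ∨-true  = λ a b t → mk⇔ (IsPrimeFilter.prime (TPTh⇒prime t))
                    [ upward (proj₁ t) (x≤x∨y a b) , upward (proj₁ t) (y≤x∨y a b) ]′
      ; ∧-true  = λ a b (t , _) → mk⇔
                    (λ a∧b → upward t (x∧y≤x a b) a∧b , upward t (x∧y≤y a b) a∧b)
                    (λ (a∈T , b∈T) → ∧-closed t a∈T b∈T)
      ; ⇒-true  = λ a b (t , _) → mk⇔
                    (λ a⇨b {_} (t′ , _) T⊆T′ → modusPonens t′ (T⊆T′ a⇨b))
                    (⇨-true t)
      ; ⊤-true  = ⊤∈
      ; ⊥-false = ⊥∉
      }

  open FilterLogic using (filterLogic; intuitionisticLogic; PTh⇒prime; prime⇒PTh)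

  -- Strongly stable maps and Heyting homomorphisms.

  module _ {ℓ : Level} (H K : NontrivialHeytingAlgebra ℓ) where
    private
      module H = NontrivialHeytingAlgebra H
      module K = NontrivialHeytingAlgebra K
      module KP = HeytingProperties K.heytingAlgebra

    stronglyStable⇒homomorphism : ∀ {f} → IsStronglyStable (filterLogic H) (filterLogic K) f →
                                  IsHeytingHomomorphism H.heytingAlgebra K.heytingAlgebra f
    stronglyStable⇒homomorphism {f} ss = record
      { cong   = λ x≈y → K.antisym (monotone (H.reflexive x≈y)) (monotone (H.reflexive (H.Eq.sym x≈y)))
      ; ∨-homo = λ x y → K.antisym
          (≤-fromPrime λ p fx∨y →
            [ upward (isProperFilter p) (K.x≤x∨y _ _) , upward (isProperFilter p) (K.y≤x∨y _ _) ]′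
              (prime (preimage p) fx∨y))
          (K.∨-least (monotone (H.x≤x∨y x y)) (monotone (H.y≤x∨y x y)))
      ; ∧-homo = λ x y → K.antisym
          (K.∧-greatest (monotone (H.x∧y≤x x y)) (monotone (H.x∧y≤y x y)))
          (≤-fromPrime λ p fx∧fy → ∧-closed (isProperFilter (preimage p))
            (upward (isProperFilter p) (K.x∧y≤x _ _) fx∧fy)
            (upward (isProperFilter p) (K.x∧y≤y _ _) fx∧fy))
      ; ⇨-homo = λ x y → K.antisym
          (K.transpose-⇨ (≤-fromPrime λ p fx⇨y∧fx →
            modusPonens (isProperFilter (preimage p))
              (upward (isProperFilter p) (K.x∧y≤x _ _) fx⇨y∧fx)
              (upward (isProperFilter p) (K.x∧y≤y _ _) fx⇨y∧fx)))
          -- Strong stability enters here: a totally prime `P` above the preimage of `P′` is itself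
          -- the preimage of some `Q′` above `P′`, and modus ponens in `Q′` takes `x` in `P` to `y`
          -- in `P`.
          (≤-fromPrime λ {P′} p fx⇨fy → FilterLogic.⇨-true H (isProperFilter (preimage p))
            λ {P} q P′f⊆P x∈P →
              let _ , q′ , P′⊆Q′ , Q′f⊆P , P⊆Q′f =
                    stronglyStable (prime⇒PTh K p) (TPTh⊆PTh (filterLogic H) q) P′f⊆P
              in  Q′f⊆P (modusPonens (proj₁ q′) (P′⊆Q′ fx⇨fy) (P⊆Q′f x∈P)))
      ; ⊤-homo = K.antisym (K.maximum _)
          (≤-fromPrime λ p _ → ⊤∈ (isProperFilter (preimage p)))
      ; ⊥-homo = K.antisym
          (≤-fromPrime λ p f⊥ → contradiction f⊥ (⊥∉ (isProperFilter (preimage p))))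
          (K.minimum _)
      }
      where
      open IsStronglyStable ss
      open IsProperFilter
      open IsPrimeFilter using (isProperFilter; prime)
      open FilterLogic K using (≤-fromPrime)

      preimage : ∀ {P} → IsPrimeFilter K P → IsPrimeFilter H (P ∘′ f)
      preimage p = PTh⇒prime H (stable (prime⇒PTh K p))

      monotone : ∀ {x y} → x H.≤ y → f x K.≤ f y
      monotone x≤y = ≤-fromPrime λ p → upward (isProperFilter (preimage p)) x≤y

    homomorphism⇒stronglyStable : ∀ {f} → IsHeytingHomomorphism H.heytingAlgebra K.heytingAlgebra f →
                                  IsStronglyStable (filterLogic H) (filterLogic K) f
    homomorphism⇒stronglyStable {f} fh = record
      { isStable = record
        { isLogicApplication = preimage
        ; stable = λ p → let p′ = PTh⇒prime K p in prime⇒PTh H record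
          { isProperFilter = preimage (proj₁ p)
          ; prime = λ fx∨y → prime p′ (upward (proj₁ p) (K.reflexive (∨-homo _ _)) fx∨y)
          }
        }
      ; stronglyStable = λ p′ p → esakia (proj₁ p′) (PTh⇒prime H p)
      }
      where
      open IsHeytingHomomorphism fh
      open IsProperFilter
      open IsPrimeFilter using (isProperFilter; prime)

      monotone : ∀ {x y} → x H.≤ y → f x K.≤ f y
      monotone {x} {y} x≤y = K.trans (K.x≤x∨y (f x) (f y)) (K.reflexive
        (K.Eq.trans (K.Eq.sym (∨-homo x y))
                    (cong (JoinProperties.x≤y⇒x∨y≈y H.joinSemilattice x≤y))))

      preimage : ∀ {F} → IsProperFilter K F → IsProperFilter H (F ∘′ f)
      preimage g = record
        { upward   = λ x≤y → upward g (monotone x≤y)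
        ; ∧-closed = λ fx fy → upward g (K.reflexive (K.Eq.sym (∧-homo _ _))) (∧-closed g fx fy)
        ; ⊤∈       = upward g (K.reflexive (K.Eq.sym ⊤-homo)) (⊤∈ g)
        ; ⊥∉       = λ f⊥ → ⊥∉ g (upward g (K.reflexive ⊥-homo) f⊥)
        }

      -- Q′ contains the filter G generated by P′ and f(P), and avoids the
      -- ideal generated by f(H ∖ P), whose complement is U.
      esakia : ∀ {P′ P} → IsProperFilter K P′ → IsPrimeFilter H P → P′ ∘′ f ⊆ P →
               ∃[ Q′ ] Q′ ∈ AbstractLogic.PTh (filterLogic K) × P′ ⊆ Q′ × Q′ ∘′ f ≐ P
      esakia {P′} {P} p′ p P′f⊆P =
        let Q′ , q′ , G⊆Q′ , Q′⊆U = FilterLogic.primeFilterTheorem K U ⊥∉U U-prime G-isProperFilter G⊆U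
        in  Q′ , prime⇒PTh K q′
          , (λ z → G⊆Q′ (P′⊆G z))
          , (λ {x} fx → Q′⊆U fx x K.refl)
          , λ {x} x∈P → G⊆Q′ (x , x∈P , FilterLogic.∈-[] K p′)
        where
        G U : Pred K.Carrier ℓ
        G z = ∃[ x ] x ∈ P × (f x K.⇨ z) ∈ P′
        U z = ∀ x → z K.≤ f x → x ∈ P

        P′⊆G : P′ ⊆ G
        P′⊆G z = H.⊤ , ⊤∈ (isProperFilter p) , upward p′ KP.y≤x⇨y z

        ⊥∉U : K.⊥ ∉ U
        ⊥∉U ⊥∈U = ⊥∉ (isProperFilter p) (⊥∈U H.⊥ (K.minimum _))

        -- If `z ≤ f x` and `w ≤ f y` with `x` and `y` outside `P`, then `z ∨ w ≤ f (x ∨ y)`, and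
        -- `x ∨ y` is outside `P` by primality.
        U-prime : ∀ {z w} → (z K.∨ w) ∈ U → z ∈ U ⊎ w ∈ U
        U-prime z∨w = byContradiction λ neither →
          neither (inj₁ λ x z≤fx → byContradiction λ x∉P →
            neither (inj₂ λ y w≤fy → byContradiction λ y∉P →
              [ x∉P , y∉P ]′ (prime p (z∨w (x H.∨ y)
                (K.∨-least (K.trans z≤fx (monotone (H.x≤x∨y x y)))
                           (K.trans w≤fy (monotone (H.y≤x∨y x y))))))))

        -- From `z ≤ f y`, preservation of implication puts `f (x ⇨ y)` in `P′`, hence `x ⇨ y` in
        -- `P`, and `x` in `P` gives `y`.
        G⊆U : G ⊆ U
        G⊆U (x , x∈P , fx⇨z) y z≤fy = modusPonens (isProperFilter p)
          (P′f⊆P (upward p′ (K.trans (KP.⇨ʳ-covariant z≤fy) (K.reflexive (K.Eq.sym (⇨-homo x y)))) fx⇨z))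
          x∈P

        G-isProperFilter : IsProperFilter K G
        G-isProperFilter = record
          { upward   = λ z≤w (x , x∈P , fx⇨z) → x , x∈P , upward p′ (KP.⇨ʳ-covariant z≤w) fx⇨z
          ; ∧-closed = λ (x , x∈P , fx⇨z) (y , y∈P , fy⇨w) →
              -- The meet serves both elements, since implication is contravariant on the left.
              x H.∧ y , ∧-closed (isProperFilter p) x∈P y∈P ,
              upward p′ (KP.⇨-distribˡ-∧-≥ _ _ _) (∧-closed p′
                (upward p′ (KP.⇨ˡ-contravariant (monotone (H.x∧y≤x x y))) fx⇨z)
                (upward p′ (KP.⇨ˡ-contravariant (monotone (H.x∧y≤y x y))) fy⇨w))
          ; ⊤∈       = P′⊆G (⊤∈ p′)
          ; ⊥∉       = λ ⊥∈G → ⊥∉U (G⊆U ⊥∈G)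
          }

  -- The Lindenbaum algebra and its filters.

  module Lindenbaum {ℓ : Level} (L : IntuitionisticLogic ℓ) where
    open IntuitionisticLogic L
    open Equivalence using (to; from)

    infix 4 _⊑_
    -- Quantifying over theories raises the level; resizing brings the order back to `ℓ`, as objects
    -- of `Hey ℓ` require.
    _⊑_ : Expr → Expr → Set ℓ
    a ⊑ b = Resize ℓ (∀ {T} → T ∈ Th → a ∈ T → b ∈ T)

    ⊑-elim : ∀ {a b T} → a ⊑ b → T ∈ Th → a ∈ T → b ∈ T
    ⊑-elim a⊑b t = unresize a⊑b t

    ⊑-fromTotallyPrime : ∀ {a b} → (∀ {T} → T ∈ TPTh → a ∈ T → b ∈ T) → a ⊑ b
    ⊑-fromTotallyPrime a→b = resize λ t a∈T →
      ∈-fromTotallyPrime abstractLogic chainClosed t λ m T⊆M → a→b m (T⊆M a∈T)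

    lindenbaumAlgebra : NontrivialHeytingAlgebra ℓ
    lindenbaumAlgebra = record
      { heytingAlgebra = record
        { Carrier = Expr
        ; _≈_ = λ a b → a ⊑ b × b ⊑ a
        ; _≤_ = _⊑_
        ; _∨_ = _∨_ ; _∧_ = _∧_ ; _⇨_ = _⇒_ ; ⊤ = ⊤ ; ⊥ = ⊥
        ; isHeytingAlgebra = record
          { isBoundedLattice = record
            { isLattice = record
              { isPartialOrder = record
                { isPreorder = record
                  { isEquivalence = record
                    { refl  = ⊑-refl , ⊑-refl
                    ; sym   = swap
                    ; trans = λ (a⊑b , b⊑a) (b⊑c , c⊑b) → ⊑-trans a⊑b b⊑c , ⊑-trans c⊑b b⊑a
                    }
                  ; reflexive = proj₁
                  ; trans     = ⊑-trans
                  }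
                ; antisym = _,_
                }
              ; supremum = λ a b →
                  ⊑-fromTotallyPrime (λ t a∈T → from (∨-true a b t) (inj₁ a∈T)) ,
                  ⊑-fromTotallyPrime (λ t b∈T → from (∨-true a b t) (inj₂ b∈T)) ,
                  λ c a⊑c b⊑c → ⊑-fromTotallyPrime λ t a∨b →
                    [ ⊑-elim a⊑c (proj₁ t) , ⊑-elim b⊑c (proj₁ t) ]′ (to (∨-true a b t) a∨b)
              ; infimum = λ a b →
                  ⊑-fromTotallyPrime (λ t a∧b → proj₁ (to (∧-true a b t) a∧b)) ,
                  ⊑-fromTotallyPrime (λ t a∧b → proj₂ (to (∧-true a b t) a∧b)) ,
                  λ c c⊑a c⊑b → ⊑-fromTotallyPrime λ t c∈T →
                    from (∧-true a b t) (⊑-elim c⊑a (proj₁ t) c∈T , ⊑-elim c⊑b (proj₁ t) c∈T)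
              }
            ; maximum = λ _ → resize λ t _ → ⊤-true t
            ; minimum = λ _ → resize λ t ⊥∈T → contradiction ⊥∈T (⊥-false t)
            }
          ; exponential = λ c a b →
              (λ c∧a⊑b → ⊑-fromTotallyPrime λ t c∈T →
                from (⇒-true a b t) λ t′ T⊆T′ a∈T′ →
                  ⊑-elim c∧a⊑b (proj₁ t′) (from (∧-true c a t′) (T⊆T′ c∈T , a∈T′))) ,
              λ c⊑a⇒b → ⊑-fromTotallyPrime λ t c∧a →
                let c∈T , a∈T = to (∧-true c a t) c∧a
                -- Modus ponens: `T` is taken as its own totally prime extension.
                in  to (⇒-true a b t) (⊑-elim c⊑a⇒b (proj₁ t) c∈T) t id a∈T
          }
        }
      ; nontrivial = λ (⊤⊑⊥ , _) → let _ , t = Th-nonEmpty in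
                     ⊥-false t (⊑-elim ⊤⊑⊥ t (⊤-true t))
      }
      where
      ⊑-refl : ∀ {a} → a ⊑ a
      ⊑-refl = resize λ _ a∈T → a∈T

      ⊑-trans : ∀ {a b c} → a ⊑ b → b ⊑ c → a ⊑ c
      ⊑-trans a⊑b b⊑c = resize λ t a∈T → ⊑-elim b⊑c t (⊑-elim a⊑b t a∈T)

    theory⇒filter : Th ⊆ IsProperFilter lindenbaumAlgebra
    theory⇒filter t = record
      { upward   = λ x⊑y → ⊑-elim x⊑y t
      ; ∧-closed = λ {x} {y} x∈T y∈T → ∈-fromTotallyPrime abstractLogic chainClosed t
                   λ m T⊆M → from (∧-true x y m) (T⊆M x∈T , T⊆M y∈T)
      ; ⊤∈       = ⊤-true t
      ; ⊥∉       = ⊥-false t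
      }

    -- The deduction theorem. It suffices to check totally prime extensions of `T`, where the clause
    -- for `⇒` looks only at further theories above `T`.
    deduction : ∀ {T a b} → T ∈ Th →
                (∀ {S} → S ∈ Th → T ⊆ S → a ∈ S → b ∈ S) → (a ⇒ b) ∈ T
    deduction {a = a} {b} t a→b = ∈-fromTotallyPrime abstractLogic chainClosed t
      λ m T⊆M → from (⇒-true a b m) λ m′ M⊆M′ → a→b (proj₁ m′) (λ x → M⊆M′ (T⊆M x))

    filter⇒theory : IsProperFilter lindenbaumAlgebra ⊆ Th
    filter⇒theory {F} f =
      -- The least theory `B` starts the Zorn argument: its elements are above `⊤`, hence in `F`.
      let B , b , B⊆⋂ , _ = Th-⋂ Th Th-nonEmpty id
          B⊆F : B ⊆ F
          B⊆F x = upward (resize λ {T} t _ → B⊆⋂ x (T , t)) ⊤∈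
          M , m , _ , M⊆F , maximal = maximalTheoryWithin abstractLogic chainClosed F b B⊆F
          F⊆M : F ⊆ M
          F⊆M {a} a∈F =
            let 𝒯 : Family
                𝒯 S = S ∈ Th × M ⊆ S × a ∈ S
                -- If no theory contained `M` and `a`, deduction would hold vacuously for `⊥`,
                -- giving `a ⇒ ⊥` in `M` and so `⊥` in `F`.
                𝒯-satisfiable : Satisfiable 𝒯
                𝒯-satisfiable = byContradiction λ empty → ⊥∉ (modusPonens
                  (M⊆F (deduction m λ {S} s M⊆S a∈S → ⊥-elim (empty (S , s , (λ {_} → M⊆S) , a∈S)))) a∈F)
                C , c , C⊆⋂ , ⋂⊆C = Th-⋂ 𝒯 𝒯-satisfiable proj₁
            in  maximal c
                  (λ x → ⋂⊆C λ (_ , _ , M⊆S , _) → M⊆S x)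
                  (λ x → modusPonens
                    (M⊆F (deduction m λ {S} s M⊆S a∈S → C⊆⋂ x (S , s , (λ {_} → M⊆S) , a∈S))) a∈F)
                  (⋂⊆C λ (_ , _ , _ , a∈S) → a∈S)
      in  Th-resp-≐ (M⊆F , F⊆M) m
      where open IsProperFilter f

    -- The two logics have the same theories, hence the same prime ones, so `P` is its own lift.
    toFilterLogic : IsStronglyStable abstractLogic (filterLogic lindenbaumAlgebra) id
    toFilterLogic = record
      { isStable = record
        { isLogicApplication = filter⇒theory
        ; stable             = IsPrime-resp filter⇒theory theory⇒filter
        }
      ; stronglyStable = λ {_} {P} _ p P′⊆P →
          P , IsPrime-resp theory⇒filter filter⇒theory p , P′⊆P , ≐-refl
      }

    fromFilterLogic : IsStronglyStable (filterLogic lindenbaumAlgebra) abstractLogic id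
    fromFilterLogic = record
      { isStable = record
        { isLogicApplication = theory⇒filter
        ; stable             = IsPrime-resp theory⇒filter filter⇒theory
        }
      ; stronglyStable = λ {_} {P} _ p P′⊆P →
          P , IsPrime-resp filter⇒theory theory⇒filter p , P′⊆P , ≐-refl
      }

  open Lindenbaum using (lindenbaumAlgebra; toFilterLogic; fromFilterLogic)

  -- The functors and the natural isomorphisms.

  module _ (ℓ : Level) where
    open Equivalence using (to; from)
    private
      module LI  = Category (LI ℓ)
      module Hey = Category (Hey ℓ)

    -- Conjugating by identity maps leaves the function unchanged and brings it into the form that
    -- `stronglyStable⇒homomorphism` accepts.
    viaFilterLogics : ∀ L L′ → LI.Hom L L′ →
                      LI.Hom (intuitionisticLogic (lindenbaumAlgebra L))
                             (intuitionisticLogic (lindenbaumAlgebra L′))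
    viaFilterLogics L L′ h =
      LI._∘_ {F} {L} {F′} (LI._∘_ {L} {L′} {F′} (id , toFilterLogic L′) h)
                          (id , fromFilterLogic L)
      where
      F F′ : IntuitionisticLogic ℓ
      F  = intuitionisticLogic (lindenbaumAlgebra L)
      F′ = intuitionisticLogic (lindenbaumAlgebra L′)

    lindenbaumFunctor : Functor (LI ℓ) (Hey ℓ)
    lindenbaumFunctor = record
      { F₀       = lindenbaumAlgebra
      ; F₁       = λ {L} {L′} h → proj₁ h ,
          stronglyStable⇒homomorphism (lindenbaumAlgebra L) (lindenbaumAlgebra L′)
            (proj₂ (viaFilterLogics L L′ h))
      ; F-resp-≈ = λ h≈k a → resize (λ t → to (h≈k a t)) , resize (λ t → from (h≈k a t))
      ; F-id     = λ {L} _ → Eq.refl (lindenbaumAlgebra L)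
      ; F-∘      = λ {_} {_} {L} _ _ _ → Eq.refl (lindenbaumAlgebra L)
      }
      where open NontrivialHeytingAlgebra

    filterFunctor : Functor (Hey ℓ) (LI ℓ)
    filterFunctor = record
      { F₀       = intuitionisticLogic
      ; F₁       = λ {H} {K} (f , fh) → f , homomorphism⇒stronglyStable H K fh
      ; F-resp-≈ = λ {_} {K} f≈g x t → mk⇔
          (IsProperFilter.upward t (reflexive K (f≈g x)))
          (IsProperFilter.upward t (reflexive K (Eq.sym K (f≈g x))))
      ; F-id     = λ _ _ → mk⇔ id id
      ; F-∘      = λ _ _ _ _ → mk⇔ id id
      }
      where open NontrivialHeytingAlgebra

    unit : NaturalIsomorphism (idF (LI ℓ)) (filterFunctor ∘F lindenbaumFunctor)
    unit = record
      { to      = λ L → id , toFilterLogic L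
      ; from    = λ L → id , fromFilterLogic L
      ; natural = λ _ _ _ → mk⇔ id id
      ; from∘to = λ _ _ _ → mk⇔ id id
      ; to∘from = λ _ _ _ → mk⇔ id id
      }

    module _ (H : NontrivialHeytingAlgebra ℓ) where
      open NontrivialHeytingAlgebra H
      open Lindenbaum (intuitionisticLogic H) using (_⊑_)

      ≤⇒⊑ : ∀ {a b} → a ≤ b → a ⊑ b
      ≤⇒⊑ a≤b = resize λ t → IsProperFilter.upward t a≤b

      -- Prime filters are theories of the filter logic and already determine the order of `H`.
      ⊑⇒≤ : ∀ {a b} → a ⊑ b → a ≤ b
      ⊑⇒≤ a⊑b = FilterLogic.≤-fromPrime H λ p → unresize a⊑b (IsPrimeFilter.isProperFilter p)

      counit-to : Hey.Hom (lindenbaumAlgebra (intuitionisticLogic H)) H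
      counit-to = id , record
        { cong   = λ (a⊑b , b⊑a) → antisym (⊑⇒≤ a⊑b) (⊑⇒≤ b⊑a)
        ; ∨-homo = λ _ _ → Eq.refl
        ; ∧-homo = λ _ _ → Eq.refl
        ; ⇨-homo = λ _ _ → Eq.refl
        ; ⊤-homo = Eq.refl
        ; ⊥-homo = Eq.refl
        }

      counit-from : Hey.Hom H (lindenbaumAlgebra (intuitionisticLogic H))
      counit-from = id , record
        { cong   = λ a≈b → ≤⇒⊑ (reflexive a≈b) , ≤⇒⊑ (reflexive (Eq.sym a≈b))
        ; ∨-homo = λ _ _ → L.Eq.refl
        ; ∧-homo = λ _ _ → L.Eq.refl
        ; ⇨-homo = λ _ _ → L.Eq.refl
        ; ⊤-homo = L.Eq.refl
        ; ⊥-homo = L.Eq.refl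
        }
        where module L = NontrivialHeytingAlgebra (lindenbaumAlgebra (intuitionisticLogic H))

    counit : NaturalIsomorphism (lindenbaumFunctor ∘F filterFunctor) (idF (Hey ℓ))
    counit = record
      { to      = counit-to
      ; from    = counit-from
      ; natural = λ {_} {K} _ _ → Eq.refl K
      ; from∘to = λ H _ → Eq.refl (lindenbaumAlgebra (intuitionisticLogic H))
      ; to∘from = λ H _ → Eq.refl H
      }
      where open NontrivialHeytingAlgebra

theorem4p9 : (∀ {a} → ExcludedMiddle a) →
    (∀ {c ℓ₁ ℓ₂ p} → ZornsLemma c ℓ₁ ℓ₂ p) →
    ∀ ℓ → CategoricalEquivalence (LI ℓ) (Hey ℓ)
theorem4p9 em zorn ℓ = record
  { F      = lindenbaumFunctor em zorn ℓ
  ; G      = filterFunctor em zorn ℓ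
  ; unit   = unit em zorn ℓ
  ; counit = counit em zorn ℓ
  }
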